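{- Let $(x_n)$ be the sequence defined recursively by $x_0=0$ and $x_{n+1}=h^{+}(x_n)$. Let $P_{rl}^{+}$ be the smallest solution of $h^{+}(x)=x$. If $pw\ge rc+cw+cc$, then $P_{rl}^{+}=\lim_{n\to+\infty}x_n$.
   Context: Parameters: an integer $P\ge 1$ (number of threads) and nonnegative reals $pw$ (work in the parallel section), $cw$ (critical work), $rc$ (Read latency), $cc$ (Compare-And-Swap latency), with $rc+cw+cc>0$. Expansion. $e:[0,P]\to[0,\infty)$ is the expansion function of the expected number of threads $x$ in the retry loop: there is a point $P_{rl}^{(0)}\geq 0$ (where expansion begins) such that $e(x)=0$ for $x\le P_{rl}^{(0)}$, and for $x\ge P_{rl}^{(0)}$, $e$ is the solution of $$e'(x)=cc\cdot\frac{\frac{cc}{2}+e(x)}{rc+cw+cc+e(x)},\qquad e(P_{rl}^{(0)})=0 .$$ For $x\in[0,P]$, the ratio of the expanded parallel section size to the expanded retry size is $\frac{pw+e(x)}{rc+cw+cc+e(x)}$; let $q=q(x)$ be its integer part and $r=r(x)\in[0,1)$ its fractional part. Let $f^{ - }=f^{ - }(x)$ be $P-q-1$ if $q\le P-1$ and $0$ otherwise (the lowest number of failures). The corresponding average number of threads inside the retry loop is $$h^{+}(x)=P\cdot\frac{1+f^{ - }}{q+r+f^{ - }+1}.$$ -}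

module Defs where

open import Level using (Level; _⊔_; Lift; lift) renaming (suc to lsuc)
open import Algebra.Bundles using (CommutativeRing)
import Algebra.Construct.NaturalChoice.Max as Max
import Algebra.Definitions.RawMonoid as RawMonoidDefinitions
import Algebra.Properties.AbelianGroup as AbelianGroupProperties
open import Data.Nat.Base as ℕ using (ℕ; zero; suc; _∸_)
open import Data.Product.Base using (∃; _×_; _,_; proj₁; proj₂)
open import Relation.Binary.Bundles using (DecTotalOrder; TotalOrder)
open import Relation.Binary.Core using (Rel)
import Relation.Binary.Construct.NonStrictToStrict as NonStrictToStrict
open import Relation.Binary.Structures using (IsDecTotalOrder)
open import Relation.Nullary.Decidable.Core using (yes; no)
open import Relation.Nullary.Negation.Core using (¬_; contradiction)
open import Relation.Unary using (Pred; Satisfiable; _∈_)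

-- The classical real line, axiomatised up to isomorphism as a
-- Dedekind-complete ordered field.
record CompleteOrderedField (c ℓ : Level) : Set (lsuc (c ⊔ ℓ)) where
  infix 8 _⁻¹
  infixl 7 _/_
  infix 4 _≤_

  field
    commutativeRing : CommutativeRing c ℓ

  open CommutativeRing commutativeRing public

  field
    _≤_             : Rel Carrier ℓ
    isDecTotalOrder : IsDecTotalOrder _≈_ _≤_

  decTotalOrder : DecTotalOrder c ℓ ℓ
  decTotalOrder = record { isDecTotalOrder = isDecTotalOrder }

  totalOrder : TotalOrder c ℓ ℓ
  totalOrder = DecTotalOrder.totalOrder decTotalOrder

  open DecTotalOrder decTotalOrder public using (_≟_; _≤?_)
  open NonStrictToStrict _≈_ _≤_ public using (_<_)

  UpperBound : ∀ {p} → Pred Carrier p → Carrier → Set (c ⊔ ℓ ⊔ p)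
  UpperBound S b = ∀ {x} → x ∈ S → x ≤ b

  -- The second clause says that nothing below s is an upper bound, in the
  -- positive form that does not need excluded middle to be used.
  IsSupremum : ∀ {p} → Pred Carrier p → Carrier → Set (c ⊔ ℓ ⊔ p)
  IsSupremum S s = UpperBound S s × (∀ {b} → b < s → ∃ λ x → x ∈ S × b < x)

  field
    _⁻¹        : Carrier → Carrier     -- unspecified at 0#
    ⁻¹-inverse : ∀ {x} → x ≉ 0# → x * x ⁻¹ ≈ 1#
    0<1        : 0# < 1#
    +-monoˡ-≤  : ∀ z {x y} → x ≤ y → x + z ≤ y + z
    *-nonNeg   : ∀ {x y} → 0# ≤ x → 0# ≤ y → 0# ≤ x * y
    supremum   : (S : Pred Carrier (c ⊔ ℓ)) → Satisfiable S → ∃ (UpperBound S) →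
                ∃ (IsSupremum S)

  _/_ : Carrier → Carrier → Carrier
  x / y = x * y ⁻¹

  open Max totalOrder public using () renaming (_⊔_ to max)

  ∣_∣ : Carrier → Carrier
  ∣ x ∣ = max x (- x)

  fromℕ : ℕ → Carrier
  fromℕ n = n · 1#
    where open RawMonoidDefinitions +-rawMonoid using () renaming (_×_ to _·_)

  module _ where
    private
      module O = DecTotalOrder decTotalOrder
      module G = AbelianGroupProperties +-abelianGroup

      +-monoˡ-< : ∀ z {x y} → x < y → x + z < y + z
      +-monoˡ-< z (x≤y , x≉y) =
        +-monoˡ-≤ z x≤y , λ eq → x≉y (G.∙-cancelʳ z _ _ eq)

      <-respˡ : ∀ {x y z} → x ≈ y → x < z → y < z
      <-respˡ x≈y (x≤z , x≉z) =
        O.≤-respˡ-≈ x≈y x≤z , λ y≈z → x≉z (trans x≈y y≈z)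

      <-respʳ : ∀ {x y z} → x ≈ y → z < x → z < y
      <-respʳ x≈y (z≤x , z≉x) =
        O.≤-respʳ-≈ x≈y z≤x , λ z≈y → z≉x (trans z≈y (sym x≈y))

      cancel : ∀ x → (x + - 1#) + 1# ≈ x
      cancel x = trans (+-assoc _ _ _)
                       (trans (+-congˡ (-‿inverseˡ 1#)) (+-identityʳ x))

      x-1<x : ∀ x → x + - 1# < x
      x-1<x x = <-respˡ (+-identityˡ _)
        (<-respʳ (trans (+-comm _ _) (cancel x)) (+-monoˡ-< (x + - 1#) 0<1))

    floor-exists : ∀ {t} → 0# ≤ t →
                   ∃ λ n → fromℕ n ≤ t × t < fromℕ (suc n)
    floor-exists {t} 0≤t
      with supremum (λ y → Lift (c ⊔ ℓ) (∃ λ n → fromℕ n ≈ y × y ≤ t))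
                    (0# , lift (0 , refl , 0≤t))
                    (t , λ { (lift (_ , _ , y≤t)) → y≤t })
    ... | s , upper , approx with approx (x-1<x s)
    ... | y , lift (n , n≈y , y≤t) , s-1<y = n , O.≤-respˡ-≈ (sym n≈y) y≤t , t<1+n
      where
      s<1+n : s < fromℕ (suc n)
      s<1+n = <-respʳ (trans (+-comm _ _) (+-congˡ (sym n≈y)))
                (<-respˡ (cancel s) (+-monoˡ-< 1# s-1<y))

      1+n≰t : ¬ (fromℕ (suc n) ≤ t)
      1+n≰t le = proj₂ s<1+n
        (O.antisym (proj₁ s<1+n) (upper (lift (suc n , refl , le))))

      t<1+n : t < fromℕ (suc n)
      t<1+n = NonStrictToStrict.≰⇒> _≈_ _≤_ sym O.reflexive O.total 1+n≰t

  -- Integer part of a nonnegative number (0 on negative arguments).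
  ⌊_⌋ : Carrier → ℕ
  ⌊ t ⌋ with 0# ≤? t
  ... | yes 0≤t = proj₁ (floor-exists 0≤t)
  ... | no  _   = 0

  ⌊⌋-spec : ∀ {t} → 0# ≤ t → fromℕ ⌊ t ⌋ ≤ t × t < fromℕ (suc ⌊ t ⌋)
  ⌊⌋-spec {t} 0≤t with 0# ≤? t
  ... | yes 0≤t′ = proj₂ (floor-exists 0≤t′)
  ... | no  0≰t  = contradiction 0≤t 0≰t

  [_,_] : Carrier → Carrier → Pred Carrier ℓ
  [ a , b ] x = a ≤ x × x ≤ b

  -- f has derivative l at x relative to D (one-sided at an endpoint of an
  -- interval D).
  HasDerivativeWithin : (D : Pred Carrier ℓ) (f : Carrier → Carrier)
                        (x l : Carrier) → Set (c ⊔ ℓ)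
  HasDerivativeWithin D f x l =
    ∀ ε → 0# < ε → ∃ λ δ → 0# < δ ×
      (∀ y → y ∈ D → y ≉ x → ∣ y - x ∣ < δ →
        ∣ (f y - f x) / (y - x) - l ∣ < ε)

  _⟶_ : (ℕ → Carrier) → Carrier → Set (c ⊔ ℓ)
  u ⟶ l = ∀ ε → 0# < ε → ∃ λ N → ∀ n → N ℕ.≤ n → ∣ u n - l ∣ < ε

  IsSmallestFixedPointOn : Pred Carrier ℓ → (Carrier → Carrier) → Carrier →
                           Set (c ⊔ ℓ)
  IsSmallestFixedPointOn D f p =
    (p ∈ D × f p ≈ p) × (∀ y → y ∈ D → f y ≈ y → p ≤ y)

  iterates : (Carrier → Carrier) → ℕ → Carrier
  iterates f zero    = 0#
  iterates f (suc n) = f (iterates f n)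

module RetryLoop {c ℓ} (R : CompleteOrderedField c ℓ)
                 (P : ℕ)
                 (pw cw rc cc : CompleteOrderedField.Carrier R) where
  open CompleteOrderedField R

  Domain : Pred Carrier ℓ
  Domain = [ 0# , fromℕ P ]

  -- e is a function [0,P] → [0,∞), represented by a function on the whole
  -- line whose values outside [0,P] are unconstrained.
  record IsExpansion (P₀ : Carrier) (e : Carrier → Carrier) : Set (c ⊔ ℓ) where
    field
      cong-on       : ∀ {x y} → x ∈ Domain → y ∈ Domain → x ≈ y → e x ≈ e y
      nonNeg        : ∀ {x} → x ∈ Domain → 0# ≤ e x
      start-nonNeg  : 0# ≤ P₀
      before-start  : ∀ {x} → x ∈ Domain → x ≤ P₀ → e x ≈ 0#
      after-start   : ∀ {x} → x ∈ [ P₀ , fromℕ P ] →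
        HasDerivativeWithin [ P₀ , fromℕ P ] e x
          (cc * ((cc / fromℕ 2 + e x) / (rc + cw + cc + e x)))

  module _ (e : Carrier → Carrier) where

    ratio : Carrier → Carrier
    ratio x = (pw + e x) / (rc + cw + cc + e x)

    q : Carrier → ℕ
    q x = ⌊ ratio x ⌋

    r : Carrier → Carrier
    r x = ratio x - fromℕ (q x)

    -- Truncated subtraction supplies the value 0 when q x > P - 1.
    f⁻ : Carrier → ℕ
    f⁻ x = P ∸ q x ∸ 1

    h⁺ : Carrier → Carrier
    h⁺ x = fromℕ P *
           ((1# + fromℕ (f⁻ x)) / (fromℕ (q x) + r x + fromℕ (f⁻ x) + 1#))

-- The ratio (pw + e) / (rc + cw + cc + e) is nonincreasing in e because
-- rc + cw + cc ≤ pw, and e is nondecreasing because its derivative is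
-- nonnegative.  With t the ratio and C = 1 + f⁻, which is nonincreasing in
-- ⌊t⌋, we have h⁺ = P C / (t + C), so h⁺ is a nondecreasing self-map of
-- [0, P], and its iterates from 0 increase to a limit below every fixed point.
-- The limit is itself a fixed point because h⁺ is left-continuous: to the left
-- of a point t approaches its value from above, where ⌊_⌋ is continuous.
module Submission where

open import Defs
open import Data.Nat.Base as ℕ using (ℕ; zero; suc)
open import Data.Product.Base using (∃; _×_; _,_; proj₁; proj₂)
import Algebra.Construct.NaturalChoice.Max as Max
import Algebra.Properties.Group as GroupProperties
import Algebra.Solver.Ring.NaturalCoefficients.Default as NatSolver
import Data.Nat.Properties as ℕₚ
open import Data.Sum.Base using (inj₁; inj₂)
open import Level using (_⊔_; Lift; lift)
open import Relation.Binary.Bundles using (DecTotalOrder)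
import Relation.Binary.Properties.DecTotalOrder as DecTotalOrderProperties
import Relation.Binary.Reasoning.PartialOrder as PartialOrderReasoning
open import Relation.Nullary.Decidable.Core using (yes; no)
open import Relation.Nullary.Negation.Core using (¬_)
open import Relation.Unary using (Pred; _∈_)

module OrderedFieldProperties {c ℓ} (R : CompleteOrderedField c ℓ) where
  open CompleteOrderedField R
  private module O = DecTotalOrder decTotalOrder
  open O using (poset; total; antisym) renaming (refl to ≤-refl; trans to ≤-trans)
  open DecTotalOrderProperties decTotalOrder using (≰⇒>; <⇒≱; ≮⇒≥; <-trans; <-respˡ-≈; <-respʳ-≈)
  open GroupProperties +-group using (//-rightDividesˡ; //-rightDividesʳ; ⁻¹-anti-homo-//; x∙y⁻¹≈ε⇒x≈y)
  open NatSolver commutativeSemiring using (solve; _:+_; _:*_; _:=_)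
  open Max totalOrder using (x≤x⊔y; x≤y⊔x; ⊔-sel)
  open PartialOrderReasoning poset

  -- Order and arithmetic in an ordered field.

  +-monoʳ-≤ : ∀ z {x y} → x ≤ y → z + x ≤ z + y
  +-monoʳ-≤ z {x} {y} x≤y = begin
    z + x  ≈⟨ +-comm z x ⟩
    x + z  ≤⟨ +-monoˡ-≤ z x≤y ⟩
    y + z  ≈⟨ +-comm y z ⟩
    z + y  ∎

  +-mono-≤ : ∀ {w x y z} → w ≤ x → y ≤ z → w + y ≤ x + z
  +-mono-≤ w≤x y≤z = ≤-trans (+-monoˡ-≤ _ w≤x) (+-monoʳ-≤ _ y≤z)

  +-cancelʳ-≤ : ∀ z {x y} → x + z ≤ y + z → x ≤ y
  +-cancelʳ-≤ z {x} {y} x+z≤y+z = begin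
    x            ≈⟨ //-rightDividesʳ z x ⟨
    x + z + - z  ≤⟨ +-monoˡ-≤ (- z) x+z≤y+z ⟩
    y + z + - z  ≈⟨ //-rightDividesʳ z y ⟩
    y            ∎

  +-cancelʳ-< : ∀ z {x y} → x + z < y + z → x < y
  +-cancelʳ-< z (x+z≤y+z , x+z≉y+z) =
    +-cancelʳ-≤ z x+z≤y+z , λ x≈y → x+z≉y+z (+-congʳ x≈y)

  +-monoʳ-< : ∀ z {x y} → x < y → z + x < z + y
  +-monoʳ-< z x<y = ≰⇒> λ z+y≤z+x → <⇒≱ x<y (+-cancelʳ-≤ z (begin
    _ + z  ≈⟨ +-comm _ z ⟩
    z + _  ≤⟨ z+y≤z+x ⟩
    z + _  ≈⟨ +-comm z _ ⟩
    _ + z  ∎))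

  +-mono-<-≤ : ∀ {w x y z} → w < x → y ≤ z → w + y < x + z
  +-mono-<-≤ {w} {x} {y} {z} w<x y≤z = begin-strict
    w + y  ≤⟨ +-monoʳ-≤ w y≤z ⟩
    w + z  ≈⟨ +-comm w z ⟩
    z + w  <⟨ +-monoʳ-< z w<x ⟩
    z + x  ≈⟨ +-comm z x ⟩
    x + z  ∎

  -- Linear arithmetic: an inequality follows from another one (in practice a
  -- combination of the hypotheses) when the differences of their sides agree.
  -- The side condition involves no subtraction, hence is a semiring identity.
  ≤-from-≤ : ∀ {l r x y} → l ≤ r → x + r ≈ y + l → x ≤ y
  ≤-from-≤ {l} {r} {x} {y} l≤r x+r≈y+l = +-cancelʳ-≤ l (begin
    x + l  ≤⟨ +-monoʳ-≤ x l≤r ⟩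
    x + r  ≈⟨ x+r≈y+l ⟩
    y + l  ∎)

  <-from-< : ∀ {l r x y} → l < r → x + r ≈ y + l → x < y
  <-from-< {l} {r} {x} {y} l<r x+r≈y+l = +-cancelʳ-< l (begin-strict
    x + l  <⟨ +-monoʳ-< x l<r ⟩
    x + r  ≈⟨ x+r≈y+l ⟩
    y + l  ∎)

  ≤-<-trans : ∀ {x y z} → x ≤ y → y < z → x < z
  ≤-<-trans {x} {y} {z} x≤y y<z = begin-strict
    x  ≤⟨ x≤y ⟩
    y  <⟨ y<z ⟩
    z  ∎

  x+[y-x]≈y : ∀ x y → x + (y - x) ≈ y
  x+[y-x]≈y x y = trans (+-comm x (y - x)) (//-rightDividesˡ x y)

  0≤y-x : ∀ {x y} → x ≤ y → 0# ≤ y - x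
  0≤y-x {x} {y} x≤y = ≤-from-≤ x≤y (trans (+-identityˡ y) (sym (//-rightDividesˡ x y)))

  0<y-x : ∀ {x y} → x < y → 0# < y - x
  0<y-x {x} {y} x<y = <-from-< x<y (trans (+-identityˡ y) (sym (//-rightDividesˡ x y)))

  -<⇒<+ : ∀ {x y z} → x - y < z → x < y + z
  -<⇒<+ {x} {y} {z} x-y<z = begin-strict
    x            ≈⟨ x+[y-x]≈y y x ⟨
    y + (x - y)  <⟨ +-monoʳ-< y x-y<z ⟩
    y + z        ∎

  <+⇒-< : ∀ {x y z} → x < y + z → x - y < z
  <+⇒-< {x} {y} {z} x<y+z = <-from-< x<y+z (begin-equality
    x - y + (y + z)  ≈⟨ +-assoc (x - y) y z ⟨
    x - y + y + z    ≈⟨ +-congʳ (//-rightDividesˡ y x) ⟩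
    x + z            ≈⟨ +-comm x z ⟩
    z + x            ∎)

  ∣x-y∣<z⇒<+ : ∀ {x y z} → ∣ x - y ∣ < z → x < y + z × y < x + z
  ∣x-y∣<z⇒<+ {x} {y} {z} lt = -<⇒<+ (begin-strict
    x - y      ≤⟨ x≤x⊔y (x - y) (- (x - y)) ⟩
    ∣ x - y ∣  <⟨ lt ⟩
    z          ∎) , -<⇒<+ (begin-strict
    y - x      ≈⟨ ⁻¹-anti-homo-// x y ⟨
    - (x - y)  ≤⟨ x≤y⊔x (x - y) (- (x - y)) ⟩
    ∣ x - y ∣  <⟨ lt ⟩
    z          ∎)

  <+⇒∣x-y∣<z : ∀ {x y z} → x < y + z → y < x + z → ∣ x - y ∣ < z
  <+⇒∣x-y∣<z {x} {y} {z} x<y+z y<x+z with ⊔-sel (x - y) (- (x - y))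
  ... | inj₁ eq = begin-strict
    ∣ x - y ∣  ≈⟨ eq ⟩
    x - y      <⟨ <+⇒-< x<y+z ⟩
    z          ∎
  ... | inj₂ eq = begin-strict
    ∣ x - y ∣  ≈⟨ eq ⟩
    - (x - y)  ≈⟨ ⁻¹-anti-homo-// x y ⟩
    y - x      <⟨ <+⇒-< y<x+z ⟩
    z          ∎

  x<x+y : ∀ x {y} → 0# < y → x < x + y
  x<x+y x {y} 0<y = <-from-< 0<y (sym (+-identityʳ (x + y)))

  x-y<x : ∀ x {y} → 0# < y → x - y < x
  x-y<x x {y} 0<y = <+⇒-< (begin-strict
    x      <⟨ x<x+y x 0<y ⟩
    x + y  ≈⟨ +-comm x y ⟩
    y + x  ∎)

  0≤x+y : ∀ {x y} → 0# ≤ x → 0# ≤ y → 0# ≤ x + y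
  0≤x+y {x} {y} 0≤x 0≤y = begin
    0#       ≈⟨ +-identityˡ 0# ⟨
    0# + 0#  ≤⟨ +-mono-≤ 0≤x 0≤y ⟩
    x + y    ∎

  0<x+y : ∀ {x y} → 0# < x → 0# ≤ y → 0# < x + y
  0<x+y {x} {y} 0<x 0≤y = begin-strict
    0#      <⟨ 0<x ⟩
    x       ≈⟨ +-identityʳ x ⟨
    x + 0#  ≤⟨ +-monoʳ-≤ x 0≤y ⟩
    x + y   ∎

  *-monoʳ-≤ : ∀ {k x y} → 0# ≤ k → x ≤ y → k * x ≤ k * y
  *-monoʳ-≤ {k} {x} {y} 0≤k x≤y = ≤-from-≤ (*-nonNeg 0≤k (0≤y-x x≤y)) (begin-equality
    k * x + k * (y - x)  ≈⟨ distribˡ k x (y - x) ⟨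
    k * (x + (y - x))    ≈⟨ *-congˡ (x+[y-x]≈y x y) ⟩
    k * y                ≈⟨ +-identityʳ (k * y) ⟨
    k * y + 0#           ∎)

  *-cancelˡ-< : ∀ {k x y} → 0# ≤ k → k * x < k * y → x < y
  *-cancelˡ-< 0≤k kx<ky = ≰⇒> λ y≤x → <⇒≱ kx<ky (*-monoʳ-≤ 0≤k y≤x)

  >⇒≉ : ∀ {x y} → x < y → y ≉ x
  >⇒≉ (_ , x≉y) y≈x = x≉y (sym y≈x)

  0<x⁻¹ : ∀ {x} → 0# < x → 0# < x ⁻¹
  0<x⁻¹ {x} 0<x = ≰⇒> λ x⁻¹≤0 → <⇒≱ 0<1 (begin
    1#         ≈⟨ ⁻¹-inverse (>⇒≉ 0<x) ⟨
    x * x ⁻¹   ≤⟨ *-monoʳ-≤ (proj₁ 0<x) x⁻¹≤0 ⟩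
    x * 0#     ≈⟨ zeroʳ x ⟩
    0#         ∎)

  *-/-cancel : ∀ {x} y → x ≉ 0# → x * (y / x) ≈ y
  *-/-cancel {x} y x≉0 = begin-equality
    x * (y * x ⁻¹)  ≈⟨ solve 3 (λ x y i → x :* (y :* i) := y :* (x :* i)) refl x y (x ⁻¹) ⟩
    y * (x * x ⁻¹)  ≈⟨ *-congˡ (⁻¹-inverse x≉0) ⟩
    y * 1#          ≈⟨ *-identityʳ y ⟩
    y               ∎

  *-cancelˡ-≤ : ∀ {k x y} → 0# < k → k * x ≤ k * y → x ≤ y
  *-cancelˡ-≤ {k} {x} {y} 0<k kx≤ky = begin
    x               ≈⟨ cancel x ⟩
    k ⁻¹ * (k * x)  ≤⟨ *-monoʳ-≤ (proj₁ (0<x⁻¹ 0<k)) kx≤ky ⟩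
    k ⁻¹ * (k * y)  ≈⟨ cancel y ⟨
    y               ∎
    where
    cancel : ∀ z → z ≈ k ⁻¹ * (k * z)
    cancel z = trans (sym (*-/-cancel z (>⇒≉ 0<k)))
      (solve 3 (λ k z i → k :* (z :* i) := i :* (k :* z)) refl k z (k ⁻¹))

  *-monoʳ-< : ∀ {k x y} → 0# < k → x < y → k * x < k * y
  *-monoʳ-< 0<k x<y = ≰⇒> λ ky≤kx → <⇒≱ x<y (*-cancelˡ-≤ 0<k ky≤kx)

  0<x*y : ∀ {x y} → 0# < x → 0# < y → 0# < x * y
  0<x*y {x} {y} 0<x 0<y = begin-strict
    0#      ≈⟨ zeroʳ x ⟨
    x * 0#  <⟨ *-monoʳ-< 0<x 0<y ⟩
    x * y   ∎

  0≤x/y : ∀ {x y} → 0# ≤ x → 0# < y → 0# ≤ x / y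
  0≤x/y 0≤x 0<y = *-nonNeg 0≤x (proj₁ (0<x⁻¹ 0<y))

  private
    -- Both rearrangement inequalities express the sign of `(x - w) * (z - y)`. Writing `x` as
    -- `w + d` leaves an identity without subtraction, which the semiring solver closes.
    rearrange-eq : ∀ w x y z → w * z + x * y + (x - w) * z ≈ w * y + x * z + (x - w) * y
    rearrange-eq w x y z = begin-equality
      w * z + x * y + d * z        ≈⟨ +-congʳ (+-congˡ (*-congʳ (x+[y-x]≈y w x))) ⟨
      w * z + (w + d) * y + d * z  ≈⟨ solve 4 (λ w y z d → w :* z :+ (w :+ d) :* y :+ d :* z
                                        := w :* y :+ (w :+ d) :* z :+ d :* y) refl w y z d ⟩
      w * y + (w + d) * z + d * y  ≈⟨ +-congʳ (+-congˡ (*-congʳ (x+[y-x]≈y w x))) ⟩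
      w * y + x * z + d * y        ∎
      where d = x - w

  rearrangement-≤ : ∀ {w x y z} → w ≤ x → y ≤ z → w * z + x * y ≤ w * y + x * z
  rearrangement-≤ {w} {x} {y} {z} w≤x y≤z =
    ≤-from-≤ (*-monoʳ-≤ (0≤y-x w≤x) y≤z) (rearrange-eq w x y z)

  rearrangement-< : ∀ {w x y z} → w < x → y < z → w * z + x * y < w * y + x * z
  rearrangement-< {w} {x} {y} {z} w<x y<z =
    <-from-< (*-monoʳ-< (0<y-x w<x) y<z) (rearrange-eq w x y z)

  ∃-scaled-below : ∀ {k g} → 0# ≤ k → 0# < g → ∃ λ η → 0# < η × k * η < g
  ∃-scaled-below {k} {g} 0≤k 0<g = η , 0<η , <-from-< 0<η (begin-equality
    k * η + η        ≈⟨ solve 2 (λ k η → k :* η :+ η := η :+ k :* η) refl k η ⟩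
    η + k * η        ≈⟨ +-congʳ (*-identityˡ η) ⟨
    1# * η + k * η   ≈⟨ distribʳ η 1# k ⟨
    (1# + k) * η     ≈⟨ *-/-cancel g (>⇒≉ 0<1+k) ⟩
    g                ≈⟨ +-identityʳ g ⟨
    g + 0#           ∎)
    where
    0<1+k = 0<x+y 0<1 0≤k
    -- Dividing by `1# + k` rather than `k` admits `k ≈ 0#`, and the slack `g - k * η` is then
    -- exactly `η`.
    η = g / (1# + k)
    0<η = 0<x*y 0<g (0<x⁻¹ 0<1+k)

  -- Serves to intersect two left neighbourhoods of `z`.
  ∃-below-both : ∀ {x y z} → x < z → y < z → ∃ λ b → b < z × x ≤ b × y ≤ b
  ∃-below-both {x} {y} x<z y<z with total x y
  ... | inj₁ x≤y = y , y<z , x≤y , ≤-refl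
  ... | inj₂ y≤x = x , x<z , ≤-refl , y≤x

  -- Natural numbers and integer parts in the field.

  fromℕ-mono-≤ : ∀ {m n} → m ℕ.≤ n → fromℕ m ≤ fromℕ n
  fromℕ-mono-≤ {n = zero}  ℕ.z≤n = ≤-refl
  fromℕ-mono-≤ {n = suc n} ℕ.z≤n = 0≤x+y (proj₁ 0<1) (fromℕ-mono-≤ {n = n} ℕ.z≤n)
  fromℕ-mono-≤ (ℕ.s≤s m≤n) = +-monoʳ-≤ 1# (fromℕ-mono-≤ m≤n)

  0≤fromℕ : ∀ n → 0# ≤ fromℕ n
  0≤fromℕ n = fromℕ-mono-≤ {n = n} ℕ.z≤n

  ⌊⌋-≤ : ∀ {x n} → 0# ≤ x → x < fromℕ (suc n) → ⌊ x ⌋ ℕ.≤ n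
  ⌊⌋-≤ {x} {n} 0≤x x<1+n = ℕₚ.≮⇒≥ λ n<⌊x⌋ → <⇒≱ x<1+n (begin
    fromℕ (suc n)  ≤⟨ fromℕ-mono-≤ n<⌊x⌋ ⟩
    fromℕ ⌊ x ⌋    ≤⟨ proj₁ (⌊⌋-spec 0≤x) ⟩
    x              ∎)

  ⌊⌋-mono-≤ : ∀ {x y} → 0# ≤ x → x ≤ y → ⌊ x ⌋ ℕ.≤ ⌊ y ⌋
  ⌊⌋-mono-≤ {x} {y} 0≤x x≤y = ⌊⌋-≤ 0≤x (begin-strict
    x                    ≤⟨ x≤y ⟩
    y                    <⟨ proj₂ (⌊⌋-spec (≤-trans 0≤x x≤y)) ⟩
    fromℕ (suc ⌊ y ⌋)    ∎)

  -- Monotonicity and one-sided continuity from derivatives.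

  module _ {f : Carrier → Carrier} {a b : Carrier} (a≤b : a ≤ b)
           (f-cong : ∀ {x y} → x ∈ [ a , b ] → y ∈ [ a , b ] → x ≈ y → f x ≈ f y)
           (f-locally-mono : ∀ {x} → x ∈ [ a , b ] → ∃ λ δ → 0# < δ × (∀ y → y ∈ [ a , b ] →
             (x < y → y < x + δ → f x ≤ f y) × (y < x → x < y + δ → f y ≤ f x)))
    where

    private
      -- The supremum s of S belongs to S because f increases just to the left of s,
      -- and s = b because otherwise points just to the right of s would belong to S.
      S : Pred Carrier (c ⊔ ℓ)
      S x = Lift (c ⊔ ℓ) (x ∈ [ a , b ] × f a ≤ f x)

      a∈S : a ∈ S
      a∈S = lift ((≤-refl , a≤b) , ≤-refl)

      S-bounded : UpperBound S b
      S-bounded (lift ((_ , x≤b) , _)) = x≤b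

      s : Carrier
      s = proj₁ (supremum S (a , a∈S) (b , S-bounded))

      s-upper : UpperBound S s
      s-upper = proj₁ (proj₂ (supremum S (a , a∈S) (b , S-bounded)))

      s-approx : ∀ {x} → x < s → ∃ λ y → y ∈ S × x < y
      s-approx = proj₂ (proj₂ (supremum S (a , a∈S) (b , S-bounded)))

      s∈[a,b] : s ∈ [ a , b ]
      s∈[a,b] = s-upper a∈S , ≮⇒≥ λ b<s →
        let (_ , x∈S , b<x) = s-approx b<s in <⇒≱ b<x (S-bounded x∈S)

      δ : Carrier
      δ = proj₁ (f-locally-mono s∈[a,b])

      0<δ : 0# < δ
      0<δ = proj₁ (proj₂ (f-locally-mono s∈[a,b]))

      near-s : ∀ y → y ∈ [ a , b ] → (s < y → y < s + δ → f s ≤ f y) × (y < s → s < y + δ → f y ≤ f s)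
      near-s = proj₂ (proj₂ (f-locally-mono s∈[a,b]))

      fa≤fs : f a ≤ f s
      fa≤fs with s-approx (x-y<x s 0<δ)
      ... | x , lift (x∈[a,b] , fa≤fx) , s-δ<x with x ≟ s
      ...   | yes x≈s = ≤-trans fa≤fx (O.reflexive (f-cong x∈[a,b] s∈[a,b] x≈s))
      ...   | no  x≉s = ≤-trans fa≤fx (proj₂ (near-s x x∈[a,b]) x<s s<x+δ)
        where
        x<s : x < s
        x<s = s-upper (lift (x∈[a,b] , fa≤fx)) , x≉s

        s<x+δ : s < x + δ
        s<x+δ = begin-strict
          s      <⟨ -<⇒<+ s-δ<x ⟩
          δ + x  ≈⟨ +-comm δ x ⟩
          x + δ  ∎

      none-above-s : ∀ {x} → s < x → x < s + δ → ¬ (x ≤ b)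
      none-above-s s<x x<s+δ x≤b = <⇒≱ s<x (s-upper (lift (x∈[a,b] ,
        ≤-trans fa≤fs (proj₁ (near-s _ x∈[a,b]) s<x x<s+δ))))
        where x∈[a,b] = ≤-trans (proj₁ s∈[a,b]) (proj₁ s<x) , x≤b

      b≤s : b ≤ s
      b≤s = ≮⇒≥ λ s<b →
        -- Scaling by `1#` merely produces some `η` strictly between `0#` and `δ`. Since `s + η`
        -- cannot lie in the interval, `b` falls below it, so `b` itself is a forbidden point just
        -- above `s`.
        let (η , 0<η , 1η<δ) = ∃-scaled-below (proj₁ 0<1) 0<δ
            s<s+η = x<x+y s 0<η
            s+η<s+δ = +-monoʳ-< s (<-respˡ-≈ (*-identityˡ η) 1η<δ)
            b<s+η = ≰⇒> λ s+η≤b → none-above-s s<s+η s+η<s+δ s+η≤b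
        in none-above-s s<b (<-trans b<s+η s+η<s+δ) ≤-refl

    -- The local hypothesis compares `f` only with its value at the centre `x`, not at two arbitrary
    -- nearby points. That is all a derivative at the single point `x` can supply.
    locally-mono⇒mono : f a ≤ f b
    locally-mono⇒mono = ≤-trans fa≤fs
      (O.reflexive (f-cong s∈[a,b] (a≤b , ≤-refl) (antisym (proj₂ s∈[a,b]) b≤s)))

  -- The slope equation cleared of division and subtraction. Read backwards by `sym`, it describes
  -- the same chord with its endpoints exchanged, so one form serves both sides of `x`.
  difference-quotient : ∀ {f : Carrier → Carrier} {x y} → y ≉ x →
    let Q = (f y - f x) / (y - x) in Q * y + f x ≈ Q * x + f y
  difference-quotient {f} {x} {y} y≉x = begin-equality
    Q * y + f x                    ≈⟨ +-congʳ (*-congˡ (x+[y-x]≈y x y)) ⟨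
    Q * (x + (y - x)) + f x        ≈⟨ solve 4 (λ Q x d z → Q :* (x :+ d) :+ z := Q :* x :+ (z :+ d :* Q)) refl Q x (y - x) (f x) ⟩
    Q * x + (f x + (y - x) * Q)    ≈⟨ +-congˡ (+-congˡ (*-/-cancel (f y - f x) y-x≉0)) ⟩
    Q * x + (f x + (f y - f x))    ≈⟨ +-congˡ (x+[y-x]≈y (f x) (f y)) ⟩
    Q * x + f y                    ∎
    where
    Q = (f y - f x) / (y - x)
    y-x≉0 : y - x ≉ 0#
    y-x≉0 y-x≈0 = y≉x (x∙y⁻¹≈ε⇒x≈y y x y-x≈0)

  module _ {D : Pred Carrier ℓ} {f : Carrier → Carrier}
           (f-cong : ∀ {x y} → x ∈ D → y ∈ D → x ≈ y → f x ≈ f y)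
    where

    module _ {f′ : Carrier → Carrier}
             (has-derivative : ∀ {x} → x ∈ D → HasDerivativeWithin D f x (f′ x))
             (0≤f′ : ∀ {x} → x ∈ D → 0# ≤ f′ x)
             {a b : Carrier} ([a,b]⊆D : ∀ {x} → x ∈ [ a , b ] → x ∈ D) (a≤b : a ≤ b)
      where

      private
        -- The tilted function gains `(Q + ε) * (v - u)` along the chord, and `Q + ε` exceeds the
        -- nonnegative `l`.
        chord-≤ : ∀ {l Q ε u v} → l < Q + ε → 0# ≤ l → u < v →
          Q * v + f u ≈ Q * u + f v → f u + ε * u ≤ f v + ε * v
        chord-≤ {l} {Q} {ε} {u} {v} l<Q+ε 0≤l u<v eq =
          ≤-from-≤ (*-monoʳ-≤ (≤-trans 0≤l (proj₁ l<Q+ε)) (proj₁ u<v)) (begin-equality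
            f u + ε * u + (Q + ε) * v
              ≈⟨ solve 5 (λ w ε u v Q → w :+ ε :* u :+ (Q :+ ε) :* v
                                     := Q :* v :+ w :+ (ε :* u :+ ε :* v)) refl (f u) ε u v Q ⟩
            Q * v + f u + (ε * u + ε * v)
              ≈⟨ +-congʳ eq ⟩
            Q * u + f v + (ε * u + ε * v)
              ≈⟨ solve 5 (λ w ε u v Q → w :+ ε :* v :+ (Q :+ ε) :* u
                                     := Q :* u :+ w :+ (ε :* u :+ ε :* v)) refl (f v) ε u v Q ⟨
            f v + ε * v + (Q + ε) * u ∎)

        -- A nonnegative derivative alone does not give local monotonicity, but it does
        -- after tilting by any ε > 0, which is then let go to 0.
        tilted-mono : ∀ {ε} → 0# < ε → f a + ε * a ≤ f b + ε * b
        tilted-mono {ε} 0<ε = locally-mono⇒mono {f = λ x → f x + ε * x} a≤b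
          (λ x∈ y∈ x≈y → +-cong (f-cong ([a,b]⊆D x∈) ([a,b]⊆D y∈) x≈y) (*-congˡ x≈y))
          local
          where
          local : ∀ {x} → x ∈ [ a , b ] → ∃ λ δ → 0# < δ × (∀ y → y ∈ [ a , b ] →
            (x < y → y < x + δ → f x + ε * x ≤ f y + ε * y) ×
            (y < x → x < y + δ → f y + ε * y ≤ f x + ε * x))
          local {x} x∈[a,b] with has-derivative ([a,b]⊆D x∈[a,b]) ε 0<ε
          ... | δ , 0<δ , close = δ , 0<δ , λ y y∈ →
            (λ x<y y<x+δ → chord-≤
              (slope y∈ (>⇒≉ x<y) (<+⇒∣x-y∣<z y<x+δ (<-trans x<y (x<x+y y 0<δ)))) (0≤f′ x∈D) x<y
              (difference-quotient {f} (>⇒≉ x<y))) ,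
            (λ y<x x<y+δ → chord-≤
              (slope y∈ (proj₂ y<x) (<+⇒∣x-y∣<z (<-trans y<x (x<x+y x 0<δ)) x<y+δ)) (0≤f′ x∈D) y<x
              (sym (difference-quotient {f} (proj₂ y<x))))
            where
            x∈D : x ∈ D
            x∈D = [a,b]⊆D x∈[a,b]

            slope : ∀ {y} → y ∈ [ a , b ] → y ≉ x → ∣ y - x ∣ < δ → f′ x < (f y - f x) / (y - x) + ε
            slope {y} y∈ y≉x lt = proj₂ (∣x-y∣<z⇒<+ (close y ([a,b]⊆D y∈) y≉x lt))

      nonNeg-derivative⇒mono : f a ≤ f b
      nonNeg-derivative⇒mono = ≮⇒≥ λ fb<fa →
        -- This `ε` makes the tilt gain over the whole interval, `(b - a) * ε`, smaller than the
        -- supposed drop `f a - f b`, so the tilted function would drop as well.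
        let (ε , 0<ε , small) = ∃-scaled-below (0≤y-x a≤b) (0<y-x fb<fa)
        in <⇒≱ (begin-strict
             f b + ε * b                    ≈⟨ +-congˡ (*-congˡ (x+[y-x]≈y a b)) ⟨
             f b + ε * (a + (b - a))        ≈⟨ solve 4 (λ w ε a d → w :+ ε :* (a :+ d) := ε :* a :+ w :+ d :* ε)
                                                 refl (f b) ε a (b - a) ⟩
             ε * a + f b + (b - a) * ε      <⟨ +-monoʳ-< (ε * a + f b) small ⟩
             ε * a + f b + (f a - f b)      ≈⟨ +-assoc (ε * a) (f b) (f a - f b) ⟩
             ε * a + (f b + (f a - f b))    ≈⟨ +-congˡ (x+[y-x]≈y (f b) (f a)) ⟩
             ε * a + f a                    ≈⟨ +-comm (ε * a) (f a) ⟩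
             f a + ε * a                    ∎)
           (tilted-mono 0<ε)

    -- Near `x` the slope stays below `K = l + 1#`, so `f x - f y` is at most `K * (x - y)`, which
    -- is small. For a nondecreasing function this one-sided bound is all of left continuity.
    derivative⇒left-lsc : ∀ {x l ε} → x ∈ D → HasDerivativeWithin D f x l → 0# ≤ l → 0# < ε →
      ∃ λ b → b < x × (∀ {y} → y ∈ D → b < y → y ≤ x → f x < f y + ε)
    derivative⇒left-lsc {x} {l} {ε} x∈D has-derivative 0≤l 0<ε =
      -- Any finite slope bound suffices, so the tolerance is simply `1#`. Then `η` limits the
      -- distance to `x` so that the slope bound costs less than `ε`.
      let (δ , 0<δ , close) = has-derivative 1# 0<1
          (η , 0<η , Kη<ε) = ∃-scaled-below (0≤x+y 0≤l (proj₁ 0<1)) 0<ε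
          (b , b<x , x-δ≤b , x-η≤b) = ∃-below-both (x-y<x x 0<δ) (x-y<x x 0<η)
      in b , b<x , left-lsc 0<δ close Kη<ε x-δ≤b x-η≤b
      where
      K = l + 1#

      x<y+ : ∀ {b y z} → x - z ≤ b → b < y → x < y + z
      x<y+ {b} {y} {z} x-z≤b b<y = begin-strict
        x            ≈⟨ x+[y-x]≈y z x ⟨
        z + (x - z)  ≤⟨ +-monoʳ-≤ z x-z≤b ⟩
        z + b        <⟨ +-monoʳ-< z b<y ⟩
        z + y        ≈⟨ +-comm z y ⟩
        y + z        ∎

      left-lsc : ∀ {δ η b} → 0# < δ →
        (∀ y → y ∈ D → y ≉ x → ∣ y - x ∣ < δ → ∣ (f y - f x) / (y - x) - l ∣ < 1#) →
        K * η < ε → x - δ ≤ b → x - η ≤ b →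
        ∀ {y} → y ∈ D → b < y → y ≤ x → f x < f y + ε
      left-lsc {δ} {η} 0<δ close Kη<ε x-δ≤b x-η≤b {y} y∈D b<y y≤x with y ≟ x
      ... | yes y≈x = begin-strict
        f x      ≈⟨ f-cong y∈D x∈D y≈x ⟨
        f y      <⟨ x<x+y (f y) 0<ε ⟩
        f y + ε  ∎
      ... | no  y≉x = +-cancelʳ-< (K * y) (begin-strict
        f x + K * y            <⟨ chord-< ⟩
        f y + K * x            ≤⟨ +-monoʳ-≤ (f y) (*-monoʳ-≤ (0≤x+y 0≤l (proj₁ 0<1)) (proj₁ (x<y+ x-η≤b b<y))) ⟩
        f y + K * (y + η)      ≈⟨ solve 4 (λ w K y η → w :+ K :* (y :+ η) := w :+ K :* y :+ K :* η)
                                    refl (f y) K y η ⟩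
        f y + K * y + K * η    <⟨ +-monoʳ-< (f y + K * y) Kη<ε ⟩
        f y + K * y + ε        ≈⟨ solve 3 (λ w k ε → w :+ k :+ ε := w :+ ε :+ k) refl (f y) (K * y) ε ⟩
        f y + ε + K * y        ∎)
        where
        Q = (f y - f x) / (y - x)

        Q<K : Q < K
        Q<K = proj₁ (∣x-y∣<z⇒<+ (close y y∈D y≉x
          (<+⇒∣x-y∣<z (begin-strict
             y      ≤⟨ y≤x ⟩
             x      <⟨ x<x+y x 0<δ ⟩
             x + δ  ∎)
           (x<y+ x-δ≤b b<y))))

        chord-< : f x + K * y < f y + K * x
        chord-< = <-from-< (rearrangement-< Q<K (y≤x , y≉x)) (begin-equality
          f x + K * y + (Q * y + K * x)    ≈⟨ solve 4 (λ w s Qy t → w :+ s :+ (Qy :+ t) := Qy :+ w :+ (s :+ t))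
                                                refl (f x) (K * y) (Q * y) (K * x) ⟩
          Q * y + f x + (K * y + K * x)    ≈⟨ +-congʳ (difference-quotient {f} y≉x) ⟩
          Q * x + f y + (K * y + K * x)    ≈⟨ solve 4 (λ w s Qx t → w :+ t :+ (Qx :+ s) := Qx :+ w :+ (s :+ t))
                                                refl (f y) (K * y) (Q * x) (K * x) ⟨
          f y + K * x + (Q * x + K * y)    ∎)

  -- Convergence of nondecreasing sequences.

  module _ {u : ℕ → Carrier} (u-mono : ∀ n → u n ≤ u (suc n)) where

    sequence-mono : ∀ {m n} → m ℕ.≤ n → u m ≤ u n
    sequence-mono m≤n = go (ℕₚ.≤⇒≤′ m≤n)
      where
      go : ∀ {m n} → m ℕ.≤′ n → u m ≤ u n
      go ℕ.≤′-refl = ≤-refl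
      go (ℕ.≤′-step m≤n) = ≤-trans (go m≤n) (u-mono _)

    mono⇒⟶ : ∀ {s} → (∀ n → u n ≤ s) → (∀ {b} → b < s → ∃ λ n → b < u n) → u ⟶ s
    mono⇒⟶ {s} u≤s approx ε 0<ε =
      let (N , s-ε<uN) = approx (x-y<x s 0<ε)
      in N , λ n N≤n → <+⇒∣x-y∣<z
        (begin-strict
          u n    ≤⟨ u≤s n ⟩
          s      <⟨ x<x+y s 0<ε ⟩
          s + ε  ∎)
        (begin-strict
          s        <⟨ -<⇒<+ s-ε<uN ⟩
          ε + u N  ≤⟨ +-monoʳ-≤ ε (sequence-mono N≤n) ⟩
          ε + u n  ≈⟨ +-comm ε (u n) ⟩
          u n + ε  ∎)

  -- Smallest fixed points by iteration from the left endpoint.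

  module _ {b : Carrier} {h : Carrier → Carrier} (0≤b : 0# ≤ b)
           (h∈ : ∀ {x} → x ∈ [ 0# , b ] → h x ∈ [ 0# , b ])
           (h-mono : ∀ {x y} → x ∈ [ 0# , b ] → y ∈ [ 0# , b ] → x ≤ y → h x ≤ h y)
           (h-left-lsc : ∀ {x z} → x ∈ [ 0# , b ] → z ∈ [ 0# , b ] → z < h x →
             ∃ λ a → a < x × (∀ {y} → y ∈ [ 0# , b ] → a < y → y ≤ x → z < h y))
    where

    private
      u : ℕ → Carrier
      u = iterates h

      u∈ : ∀ n → u n ∈ [ 0# , b ]
      u∈ zero    = ≤-refl , 0≤b
      u∈ (suc n) = h∈ (u∈ n)

      u-mono : ∀ n → u n ≤ u (suc n)
      u-mono zero    = proj₁ (u∈ 1)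
      u-mono (suc n) = h-mono (u∈ n) (u∈ (suc n)) (u-mono n)

      u≤fixed-point : ∀ {y} → y ∈ [ 0# , b ] → h y ≈ y → ∀ n → u n ≤ y
      u≤fixed-point y∈ hy≈y zero    = proj₁ y∈
      u≤fixed-point {y} y∈ hy≈y (suc n) = begin
        h (u n)  ≤⟨ h-mono (u∈ n) y∈ (u≤fixed-point y∈ hy≈y n) ⟩
        h y      ≈⟨ hy≈y ⟩
        y        ∎

      S : Pred Carrier (c ⊔ ℓ)
      S x = Lift (c ⊔ ℓ) (∃ λ n → u n ≈ x)

      limit : ∃ (IsSupremum S)
      limit = supremum S (0# , lift (0 , refl))
        (b , λ (lift (n , un≈x)) → O.≤-respˡ-≈ un≈x (proj₂ (u∈ n)))

      s : Carrier
      s = proj₁ limit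

      u≤s : ∀ n → u n ≤ s
      u≤s n = proj₁ (proj₂ limit) (lift (n , refl))

      s-approx : ∀ {a} → a < s → ∃ λ n → a < u n
      s-approx a<s with proj₂ (proj₂ limit) a<s
      ... | _ , lift (n , un≈x) , a<x = n , <-respʳ-≈ (sym un≈x) a<x

      s≤ : ∀ {y} → (∀ n → u n ≤ y) → s ≤ y
      s≤ u≤y = ≮⇒≥ λ y<s → let (n , y<un) = s-approx y<s in <⇒≱ y<un (u≤y n)

      s∈ : s ∈ [ 0# , b ]
      s∈ = u≤s 0 , s≤ λ n → proj₂ (u∈ n)

      hs≤s : h s ≤ s
      hs≤s = ≮⇒≥ λ s<hs →
        -- The threshold is `s` itself: `h` would exceed `s` on a left neighbourhood of `s`. That
        -- neighbourhood contains some `u n`, so `u (suc n)` would overshoot the supremum.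
        let (a , a<s , lsc) = h-left-lsc s∈ s∈ s<hs
            (n , a<un) = s-approx a<s
        in <⇒≱ (lsc (u∈ n) a<un (u≤s n)) (u≤s (suc n))

      s≤hs : s ≤ h s
      s≤hs = s≤ λ n → ≤-trans (u-mono n) (h-mono (u∈ n) s∈ (u≤s n))

    iterates⟶smallestFixedPoint :
      ∃ λ p → IsSmallestFixedPointOn [ 0# , b ] h p × (iterates h ⟶ p)
    iterates⟶smallestFixedPoint =
      s , ((s∈ , antisym hs≤s s≤hs) , λ y y∈ hy≈y → s≤ (u≤fixed-point y∈ hy≈y)) ,
      mono⇒⟶ u-mono u≤s s-approx

-- The expansion function.

module RetryLoopProperties {c ℓ} (R : CompleteOrderedField c ℓ) (P : ℕ)
                           (pw cw rc cc : CompleteOrderedField.Carrier R) where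
  open CompleteOrderedField R
  open RetryLoop R P pw cw rc cc
  open OrderedFieldProperties R
  private module O = DecTotalOrder decTotalOrder
  open O using (poset; total) renaming (trans to ≤-trans)
  open DecTotalOrderProperties decTotalOrder using (≰⇒>)
  open NatSolver commutativeSemiring using (solve; _:+_; _:*_; _:=_)
  open PartialOrderReasoning poset

  module Expanding (0≤cc : 0# ≤ cc) (0<rc+cw+cc : 0# < rc + cw + cc)
                   (rc+cw+cc≤pw : rc + cw + cc ≤ pw)
                   {P₀ : Carrier} {e : Carrier → Carrier}
                   (isExpansion : IsExpansion P₀ e) where

    open IsExpansion isExpansion

    private
      d : Carrier
      d = rc + cw + cc

      [P₀,P] : Pred Carrier ℓ
      [P₀,P] = [ P₀ , fromℕ P ]

      [P₀,P]⊆Domain : ∀ {x} → x ∈ [P₀,P] → x ∈ Domain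
      [P₀,P]⊆Domain (P₀≤x , x≤P) = ≤-trans start-nonNeg P₀≤x , x≤P

      e-cong : ∀ {x y} → x ∈ [P₀,P] → y ∈ [P₀,P] → x ≈ y → e x ≈ e y
      e-cong x∈ y∈ = cong-on ([P₀,P]⊆Domain x∈) ([P₀,P]⊆Domain y∈)

      e′ : Carrier → Carrier
      e′ x = cc * ((cc / fromℕ 2 + e x) / (d + e x))

      0<2 : 0# < fromℕ 2
      0<2 = 0<x+y 0<1 (0≤fromℕ 1)

    0<d+e : ∀ {x} → x ∈ Domain → 0# < d + e x
    0<d+e x∈ = 0<x+y 0<rc+cw+cc (nonNeg x∈)

    0≤e′ : ∀ {x} → x ∈ [P₀,P] → 0# ≤ e′ x
    0≤e′ x∈ = *-nonNeg 0≤cc (0≤x/y (0≤x+y (0≤x/y 0≤cc 0<2) (nonNeg x∈D)) (0<d+e x∈D))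
      where x∈D = [P₀,P]⊆Domain x∈

    -- If `x` is at most `P₀`, then `e x` vanishes and nonnegativity of `e y` suffices. The
    -- derivative is therefore needed only on intervals entirely past `P₀`.
    e-mono : ∀ {x y} → x ∈ Domain → y ∈ Domain → x ≤ y → e x ≤ e y
    e-mono {x} {y} x∈ y∈ x≤y with total x P₀
    ... | inj₁ x≤P₀ = begin
      e x  ≈⟨ before-start x∈ x≤P₀ ⟩
      0#   ≤⟨ nonNeg y∈ ⟩
      e y  ∎
    ... | inj₂ P₀≤x = nonNeg-derivative⇒mono e-cong after-start 0≤e′
      (λ (x≤z , z≤y) → ≤-trans P₀≤x x≤z , ≤-trans z≤y (proj₂ y∈)) x≤y

    e-left-lsc : ∀ {x ε} → x ∈ Domain → 0# < ε →
      ∃ λ b → b < x × (∀ {y} → y ∈ Domain → b < y → y ≤ x → e x < e y + ε)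
    e-left-lsc {x} {ε} x∈ 0<ε with x ≤? P₀
    -- Everything to the left of `x` is on the flat piece, even when `x` is `P₀`, so any bound below
    -- `x` would do.
    ... | yes x≤P₀ = x - 1# , x-y<x x 0<1 , λ {y} y∈ _ y≤x → begin-strict
      e x      ≈⟨ before-start x∈ x≤P₀ ⟩
      0#       ≈⟨ before-start y∈ (≤-trans y≤x x≤P₀) ⟨
      e y      <⟨ x<x+y (e y) 0<ε ⟩
      e y + ε  ∎
    ... | no  x≰P₀ =
      let x∈[P₀,P] = proj₁ (≰⇒> x≰P₀) , proj₂ x∈
          (b₁ , b₁<x , lsc) = derivative⇒left-lsc e-cong x∈[P₀,P] (after-start x∈[P₀,P]) (0≤e′ x∈[P₀,P]) 0<ε
          -- Raising the bound to at least `P₀` keeps `y` where the differential equation holds.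
          (b , b<x , b₁≤b , P₀≤b) = ∃-below-both b₁<x (≰⇒> x≰P₀)
      in b , b<x , λ {y} y∈ b<y y≤x →
           lsc (≤-trans P₀≤b (proj₁ b<y) , proj₂ y∈) (≤-<-trans b₁≤b b<y) y≤x

    -- The ratio of the expanded sizes.

    ratio-spec : ∀ {x} → x ∈ Domain → (d + e x) * ratio e x ≈ pw + e x
    ratio-spec x∈ = *-/-cancel _ (>⇒≉ (0<d+e x∈))

    0≤ratio : ∀ {x} → x ∈ Domain → 0# ≤ ratio e x
    0≤ratio x∈ = 0≤x/y (0≤x+y (≤-trans (proj₁ 0<rc+cw+cc) rc+cw+cc≤pw) (nonNeg x∈)) (0<d+e x∈)

    -- After cross-multiplication the two sides differ by `(pw - d) * (e y - e x)`, whose sign is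
    -- settled by `rc+cw+cc≤pw` and `e-mono`.
    ratio-antitone : ∀ {x y} → x ∈ Domain → y ∈ Domain → x ≤ y → ratio e y ≤ ratio e x
    ratio-antitone {x} {y} x∈ y∈ x≤y = *-cancelˡ-≤ (0<x*y (0<d+e x∈) (0<d+e y∈)) (begin
      F x * F y * ratio e y        ≈⟨ *-assoc (F x) (F y) (ratio e y) ⟩
      F x * (F y * ratio e y)      ≈⟨ *-congˡ (ratio-spec y∈) ⟩
      F x * (pw + e y)             ≤⟨ cross ⟩
      F y * (pw + e x)             ≈⟨ *-congˡ (ratio-spec x∈) ⟨
      F y * (F x * ratio e x)      ≈⟨ solve 3 (λ a b w → b :* (a :* w) := a :* b :* w) refl (F x) (F y) (ratio e x) ⟩
      F x * F y * ratio e x        ∎)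
      where
      F : Carrier → Carrier
      F z = d + e z

      cross : F x * (pw + e y) ≤ F y * (pw + e x)
      cross = ≤-from-≤ (rearrangement-≤ rc+cw+cc≤pw (e-mono x∈ y∈ x≤y))
        (solve 4 (λ d p a b → (d :+ a) :* (p :+ b) :+ (d :* a :+ p :* b)
                           := (d :+ b) :* (p :+ a) :+ (d :* b :+ p :* a)) refl d pw (e x) (e y))

    ratio-left-usc : ∀ {x η} → x ∈ Domain → 0# < η →
      ∃ λ b → b < x × (∀ {y} → y ∈ Domain → b < y → y ≤ x → ratio e y < ratio e x + η)
    ratio-left-usc {x} {η} x∈ 0<η =
      -- Lowering `e x` by at most `ε` costs `(d + e x) * (W + η)` at most `(W + η) * ε`. This is
      -- less than its surplus `η * (d + e x)` over `(d + e x) * W`.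
      let (ε , 0<ε , small) = ∃-scaled-below (0≤x+y (0≤ratio x∈) (proj₁ 0<η)) (0<x*y 0<η (0<d+e x∈))
          (b , b<x , lsc) = e-left-lsc x∈ 0<ε
      in b , b<x , λ y∈ b<y y≤x → bound small y∈ y≤x (lsc y∈ b<y y≤x)
      where
      W = ratio e x

      bound : ∀ {ε y} → (W + η) * ε < η * (d + e x) → y ∈ Domain → y ≤ x → e x < e y + ε →
              ratio e y < W + η
      bound {ε} {y} small y∈ y≤x ex<ey+ε = *-cancelˡ-< (proj₁ (0<d+e y∈)) (begin-strict
        (d + e y) * ratio e y   ≈⟨ ratio-spec y∈ ⟩
        pw + e y                ≤⟨ +-monoʳ-≤ pw (e-mono y∈ x∈ y≤x) ⟩
        pw + e x                ≈⟨ ratio-spec x∈ ⟨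
        (d + e x) * W           <⟨ <-from-< (+-mono-<-≤ small (*-monoʳ-≤ (0≤x+y (0≤ratio x∈) (proj₁ 0<η)) (proj₁ ex<ey+ε)))
          (solve 6 (λ d a b w η ε → (d :+ a) :* w :+ (η :* (d :+ a) :+ (w :+ η) :* (b :+ ε))
                                 := (d :+ b) :* (w :+ η) :+ ((w :+ η) :* ε :+ (w :+ η) :* a))
            refl d (e x) (e y) W η ε) ⟩
        (d + e y) * (W + η)     ∎)

    -- The map `h⁺`: range, monotonicity and left lower semicontinuity.

    private
      -- Unfolds definitionally to `1# + fromℕ (f⁻ e x)`, the numerator in `h⁺`.
      C : Carrier → Carrier
      C x = fromℕ (suc (f⁻ e x))

    0<C : ∀ x → 0# < C x
    0<C x = 0<x+y 0<1 (0≤fromℕ (f⁻ e x))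

    0<ratio+C : ∀ {x} → x ∈ Domain → 0# < ratio e x + C x
    0<ratio+C {x} x∈ = begin-strict
      0#               <⟨ 0<x+y (0<C x) (0≤ratio x∈) ⟩
      C x + ratio e x  ≈⟨ +-comm (C x) (ratio e x) ⟩
      ratio e x + C x  ∎

    private
      denominator : Carrier → Carrier
      denominator x = fromℕ (q e x) + r e x + fromℕ (f⁻ e x) + 1#

      -- Integer and fractional part recombine into the ratio, so the integer part affects `h⁺` only
      -- through `C`.
      denominator≈ratio+C : ∀ x → denominator x ≈ ratio e x + C x
      denominator≈ratio+C x = begin-equality
        fromℕ (q e x) + r e x + fromℕ (f⁻ e x) + 1#  ≈⟨ +-congʳ (+-congʳ (x+[y-x]≈y (fromℕ (q e x)) (ratio e x))) ⟩
        ratio e x + fromℕ (f⁻ e x) + 1#              ≈⟨ solve 3 (λ w f i → w :+ f :+ i := w :+ (i :+ f))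
                                                          refl (ratio e x) (fromℕ (f⁻ e x)) 1# ⟩
        ratio e x + C x                              ∎

      0<denominator : ∀ {x} → x ∈ Domain → 0# < denominator x
      0<denominator {x} x∈ = O.≤-respʳ-≈ (sym (denominator≈ratio+C x)) (proj₁ (0<ratio+C x∈)) ,
        λ 0≈ → proj₂ (0<ratio+C x∈) (trans 0≈ (denominator≈ratio+C x))

    h⁺-spec : ∀ {x} → x ∈ Domain → (ratio e x + C x) * h⁺ e x ≈ fromℕ P * C x
    h⁺-spec {x} x∈ = begin-equality
      (ratio e x + C x) * h⁺ e x                       ≈⟨ *-congʳ (denominator≈ratio+C x) ⟨
      denominator x * (fromℕ P * (C x / denominator x)) ≈⟨ solve 3 (λ n p k → n :* (p :* k) := p :* (n :* k))
                                                            refl (denominator x) (fromℕ P) (C x / denominator x) ⟩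
      fromℕ P * (denominator x * (C x / denominator x)) ≈⟨ *-congˡ (*-/-cancel (C x) (>⇒≉ (0<denominator x∈))) ⟩
      fromℕ P * C x                                     ∎

    h⁺∈Domain : ∀ {x} → x ∈ Domain → h⁺ e x ∈ Domain
    h⁺∈Domain {x} x∈ =
      *-nonNeg (0≤fromℕ P) (0≤x/y (proj₁ (0<C x)) (0<denominator x∈)) ,
      *-cancelˡ-≤ (0<ratio+C x∈) (begin
        (ratio e x + C x) * h⁺ e x         ≈⟨ h⁺-spec x∈ ⟩
        fromℕ P * C x                      ≈⟨ +-identityˡ (fromℕ P * C x) ⟨
        0# + fromℕ P * C x                 ≤⟨ +-monoˡ-≤ (fromℕ P * C x) (*-nonNeg (0≤fromℕ P) (0≤ratio x∈)) ⟩
        fromℕ P * ratio e x + fromℕ P * C x ≈⟨ solve 3 (λ p w k → p :* w :+ p :* k := (w :+ k) :* p)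
                                                refl (fromℕ P) (ratio e x) (C x) ⟩
        (ratio e x + C x) * fromℕ P        ∎)

    -- Truncated subtraction is antitone in its second argument throughout, which covers both cases
    -- of `f⁻` without a split.
    C-antitone-q : ∀ {x y} → q e y ℕ.≤ q e x → C x ≤ C y
    C-antitone-q qy≤qx = fromℕ-mono-≤ (ℕ.s≤s (ℕₚ.∸-monoˡ-≤ 1 (ℕₚ.∸-monoʳ-≤ P qy≤qx)))

    -- In `p * C / (ratio + C)`, a falling ratio and a growing `C` act in the same direction.
    -- Cross-multiplying cancels the term `C y * C x` and leaves
    -- `C x * ratio e y ≤ ratio e x * C y`.
    h⁺-mono : ∀ {x y} → x ∈ Domain → y ∈ Domain → x ≤ y → h⁺ e x ≤ h⁺ e y
    h⁺-mono {x} {y} x∈ y∈ x≤y = *-cancelˡ-≤ (0<x*y (0<ratio+C x∈) (0<ratio+C y∈)) (begin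
      X x * X y * h⁺ e x      ≈⟨ solve 3 (λ a b h → a :* b :* h := b :* (a :* h)) refl (X x) (X y) (h⁺ e x) ⟩
      X y * (X x * h⁺ e x)    ≈⟨ *-congˡ (h⁺-spec x∈) ⟩
      X y * (p * C x)         ≤⟨ cross ⟩
      X x * (p * C y)         ≈⟨ *-congˡ (h⁺-spec y∈) ⟨
      X x * (X y * h⁺ e y)    ≈⟨ *-assoc (X x) (X y) (h⁺ e y) ⟨
      X x * X y * h⁺ e y      ∎)
      where
      p = fromℕ P

      X : Carrier → Carrier
      X z = ratio e z + C z

      W-antitone : ratio e y ≤ ratio e x
      W-antitone = ratio-antitone x∈ y∈ x≤y

      C-mono : C x ≤ C y
      C-mono = C-antitone-q {x} {y} (⌊⌋-mono-≤ (0≤ratio y∈) W-antitone)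

      cross : X y * (p * C x) ≤ X x * (p * C y)
      cross = begin
        (ratio e y + C y) * (p * C x)          ≈⟨ solve 4 (λ w k p j → (w :+ k) :* (p :* j) := p :* (j :* w :+ k :* j))
                                                    refl (ratio e y) (C y) p (C x) ⟩
        p * (C x * ratio e y + C y * C x)      ≤⟨ *-monoʳ-≤ (0≤fromℕ P) (+-monoˡ-≤ (C y * C x) (begin
          C x * ratio e y                        ≤⟨ *-monoʳ-≤ (proj₁ (0<C x)) W-antitone ⟩
          C x * ratio e x                        ≈⟨ *-comm (C x) (ratio e x) ⟩
          ratio e x * C x                        ≤⟨ *-monoʳ-≤ (0≤ratio x∈) C-mono ⟩
          ratio e x * C y                        ∎)) ⟩
        p * (ratio e x * C y + C y * C x)      ≈⟨ solve 4 (λ w k p j → (w :+ k) :* (p :* j) := p :* (w :* j :+ j :* k))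
                                                    refl (ratio e x) (C x) p (C y) ⟨
        (ratio e x + C x) * (p * C y)          ∎

    -- The strict inequality `z < h⁺ e x` leaves room for a slightly larger ratio with `C x` held
    -- fixed. Passing from `C x` to `C y` then does no harm, because `C` does not drop just to the
    -- left of `x`.
    h⁺-left-lsc : ∀ {x z} → x ∈ Domain → z ∈ Domain → z < h⁺ e x →
      ∃ λ b → b < x × (∀ {y} → y ∈ Domain → b < y → y ≤ x → z < h⁺ e y)
    h⁺-left-lsc {x} {z} x∈ z∈ z<hx =
      let (η₁ , 0<η₁ , small) = ∃-scaled-below (proj₁ z∈) (0<y-x gap)
          (b₁ , b₁<x , usc₁) = ratio-left-usc x∈ 0<η₁
          -- The tolerance is the distance from the ratio up to the next integer. It is positive
          -- even at a jump of the integer part, and staying within it gives `q e y ≤ q e x`.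
          (b₂ , b₂<x , usc₂) = ratio-left-usc x∈ (0<y-x (proj₂ (⌊⌋-spec (0≤ratio x∈))))
          (b , b<x , b₁≤b , b₂≤b) = ∃-below-both b₁<x b₂<x
      in b , b<x , λ y∈ b<y y≤x → bound small y∈
           (usc₁ y∈ (≤-<-trans b₁≤b b<y) y≤x)
           (usc₂ y∈ (≤-<-trans b₂≤b b<y) y≤x)
      where
      p = fromℕ P
      W = ratio e x

      gap : z * (W + C x) < p * C x
      gap = begin-strict
        z * (W + C x)        ≈⟨ *-comm z (W + C x) ⟩
        (W + C x) * z        <⟨ *-monoʳ-< (0<ratio+C x∈) z<hx ⟩
        (W + C x) * h⁺ e x   ≈⟨ h⁺-spec x∈ ⟩
        p * C x              ∎

      bound : ∀ {η y} → z * η < p * C x - z * (W + C x) → y ∈ Domain → ratio e y < W + η →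
              ratio e y < W + (fromℕ (suc (q e x)) - W) → z < h⁺ e y
      bound {η} {y} small y∈ Wy<W+η Wy<1+q = *-cancelˡ-< (proj₁ (0<ratio+C y∈)) (begin-strict
        -- Replacing `C x` by `C y` in `near` adds `(p - z) * (C y - C x)` to the slack. This is
        -- nonnegative because `z` lies in `Domain`.
        (ratio e y + C y) * z   <⟨ <-from-< (+-mono-<-≤ near (rearrangement-≤ (proj₂ z∈) Cx≤Cy))
          (solve 5 (λ w k j z p → (w :+ j) :* z :+ (p :* k :+ (z :* k :+ p :* j))
                               := p :* j :+ (z :* (w :+ k) :+ (z :* j :+ p :* k)))
            refl (ratio e y) (C x) (C y) z p) ⟩
        p * C y                 ≈⟨ h⁺-spec y∈ ⟨
        (ratio e y + C y) * h⁺ e y ∎)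
        where
        near : z * (ratio e y + C x) < p * C x
        near = begin-strict
          z * (ratio e y + C x)      ≤⟨ *-monoʳ-≤ (proj₁ z∈) (+-monoˡ-≤ (C x) (proj₁ Wy<W+η)) ⟩
          z * (W + η + C x)          ≈⟨ solve 4 (λ z w η k → z :* (w :+ η :+ k) := z :* (w :+ k) :+ z :* η)
                                          refl z W η (C x) ⟩
          z * (W + C x) + z * η      <⟨ +-monoʳ-< (z * (W + C x)) small ⟩
          z * (W + C x) + (p * C x - z * (W + C x))  ≈⟨ x+[y-x]≈y (z * (W + C x)) (p * C x) ⟩
          p * C x                    ∎

        Cx≤Cy : C x ≤ C y
        Cx≤Cy = C-antitone-q {x} {y} (⌊⌋-≤ (0≤ratio y∈) (begin-strict
          ratio e y                        <⟨ Wy<1+q ⟩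
          W + (fromℕ (suc (q e x)) - W)    ≈⟨ x+[y-x]≈y W (fromℕ (suc (q e x))) ⟩
          fromℕ (suc (q e x))              ∎))

theorem3 : ∀ {c ℓ} (R : CompleteOrderedField c ℓ) →
    let open CompleteOrderedField R in
    (P : ℕ) (pw cw rc cc : Carrier) →
    1 ℕ.≤ P →
    0# ≤ pw → 0# ≤ cw → 0# ≤ rc → 0# ≤ cc →
    0# < rc + cw + cc →
    let open RetryLoop R P pw cw rc cc in
    (P₀ : Carrier) (e : Carrier → Carrier) → IsExpansion P₀ e →
    rc + cw + cc ≤ pw →
    ∃ λ Prl⁺ → IsSmallestFixedPointOn Domain (h⁺ e) Prl⁺ × (iterates (h⁺ e) ⟶ Prl⁺)
theorem3 R P pw cw rc cc _ _ _ _ 0≤cc 0<rc+cw+cc P₀ e isExpansion rc+cw+cc≤pw =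
  -- The witness is the supremum of the iterates, so the existence of a smallest fixed point is
  -- established together with the convergence.
  iterates⟶smallestFixedPoint (0≤fromℕ P) h⁺∈Domain h⁺-mono h⁺-left-lsc
  where
  open OrderedFieldProperties R
  open RetryLoopProperties.Expanding R P pw cw rc cc 0≤cc 0<rc+cw+cc rc+cw+cc≤pw isExpansion
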